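{- Let $\mathcal N$ be a negotiation diagram, and let $[\![\cdot]\!]$ be an analysis framework for $\mathcal N$. If $\mathcal N$ is deterministic and $[\![\cdot]\!]$ is Mazurkiewicz invariant, then $[\![\mathcal N,S]\!]=[\![\mathcal N,S']\!]$ for every two schedulers $S,S'$ of $\mathcal N$, and so $[\![\mathcal N]\!]=[\![\mathcal N,S]\!]$ for every scheduler $S$ of $\mathcal N$.
   Context: A negotiation diagram $\mathcal N$ is a tuple $(\mathrm{Proc},N,\mathrm{dom},R,\delta)$: $\mathrm{Proc}$ is a finite set of processes, $N$ a finite set of nodes, $\mathrm{dom}(n)\subseteq \mathrm{Proc}$ is a nonempty set for every node $n$, $R$ is a set of outcomes, each node $n$ has a set $\mathrm{out}(n)\subseteq R$ of outcomes, and for every $n\in N$, $a\in \mathrm{out}(n)$, $p\in\mathrm{dom}(n)$ a set $\delta(n,a,p)\subseteq N$ is given such that $p\in\mathrm{dom}(n')$ for all $n'\in\delta(n,a,p)$. There are two distinguished nodes $n_{init},n_{fin}$ with $\mathrm{dom}(n_{init})=\mathrm{dom}(n_{fin})=\mathrm{Proc}$. Every node except $n_{fin}$ has at least one outcome. $\mathcal N$ is deterministic if every $\delta(n,a,p)$ is a singleton or empty. A location is a pair $\ell=(n,a)$ with $a\in\mathrm{out}(n)$; its domain is $\mathrm{dom}(n)$. A configuration is a map $C:\mathrm{Proc}\to\mathcal P(N)$. A node $n$ is enabled in $C$ if $n\in C(p)$ for all $p\in\mathrm{dom}(n)$. If $n$ is enabled in $C$ and $a\in \mathrm{out}(n)$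 then $C\xrightarrow{(n,a)}C'$, where $C'(p)=\delta(n,a,p)$ for $p\in\mathrm{dom}(n)$ and $C'(p)=C(p)$ otherwise. A run from $C$ is a sequence $w$ of locations that can be executed successively from $C$; write $C\xrightarrow{w}C'$ if $w$ is finite and leads from $C$ to $C'$. $C_{init}(p)=\{n_{init}\}$ and $C_{fin}(p)=\{n_{fin}\}$ for all $p$. A run is successful if it starts in $C_{init}$ and ends in $C_{fin}$. An analysis framework for $\mathcal N$ is a complete lattice $(D,\sqcup,\sqcap,\sqsubseteq,\bot,\top)$ together with a map assigning to every location $\ell$ a monotone and distributive function $[\![\ell]\!]:D\to D$ (distributive: $f(\bigsqcup D')=\bigsqcup\{f(d)\mid d\in D'\}$ for every nonempty $D'\subseteq D$). For a finite run $w=\ell_1\cdots\ell_k$ put $[\![w]\!]=[\![\ell_k]\!]\circ\cdots\circ[\![\ell_1]\!]$. A scheduler $S$ of $\mathcal N$ is a partial function assigning to every run $C_{init}\xrightarrow{w}C$ a node $S(w)$ enabled at $C$, if one exists. A finite run $w=\ell_1\cdots\ell_k$ from $C_{init}$, with $\ell_i=(n_i,a_i)$, is compatible with $S$ if $S(\ell_1\cdots\ell_i)=n_{i+1}$ for every $1\le i\le k-1$. Put $[\![\mathcal N,S]\!]=\bigsqcup\{[\![w]\!]\mid w$ a successful run of $\mathcal N$ compatible with $S\}$ (pointwise join). The abstract semantics $[\![\mathcal N]\!]$ is defined either as the pointwise meet $\inf_S[\![\mathcal N,S]\!]$ or as $\bigsqcup_S[\![\mathcal N,S]\!]$ over all schedulers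 $S$, depending on the application (the result holds for both choices). Two locations are independent if their domains are disjoint. The framework is Mazurkiewicz invariant if $[\![\ell_1]\!]\circ[\![\ell_2]\!]=[\![\ell_2]\!]\circ[\![\ell_1]\!]$ for every two independent locations $\ell_1,\ell_2$. -}

module Defs where

open import Level using (_⊔_; suc)
open import Data.Fin using (Fin)
open import Data.Fin.Subset using (Subset; _∈_; _∉_; _∩_; ⊤; ⁅_⁆; Nonempty; Empty)
open import Data.List using (List; []; _∷_; _++_)
open import Data.Maybe using (Maybe; just)
open import Data.Nat using (ℕ)
open import Data.Product using (Σ; ∃-syntax; _×_; proj₁)
open import Data.Sum using (_⊎_)
open import Relation.Binary.Definitions using (Monotonic₁)
open import Relation.Binary.Lattice using (BoundedLattice)
open import Relation.Binary.PropositionalEquality using (_≡_; _≢_; _≗_)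
open import Relation.Unary using (Pred)

-- Subsets are presented as ranges of families I → Carrier with I : Set s.
-- A subset P is the family proj₁ : Σ Carrier P → Carrier; quantifying over
-- families rather than predicates keeps the notion predicatively inhabited.

record CompleteLattice c ℓ₁ ℓ₂ s : Set (suc (c ⊔ ℓ₁ ⊔ ℓ₂ ⊔ s)) where
  field
    boundedLattice : BoundedLattice c ℓ₁ ℓ₂

  open BoundedLattice boundedLattice public
    renaming (_≤_ to _⊑_; _∨_ to _⊔ᴸ_; _∧_ to _⊓ᴸ_; ⊤ to ⊤ᴸ; ⊥ to ⊥ᴸ)

  field
    ⨆ : {I : Set s} → (I → Carrier) → Carrier
    ⨅ : {I : Set s} → (I → Carrier) → Carrier
    ⨆-upper    : {I : Set s} (x : I → Carrier) → ∀ i → x i ⊑ ⨆ x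
    ⨆-least    : {I : Set s} (x : I → Carrier) → ∀ u → (∀ i → x i ⊑ u) → ⨆ x ⊑ u
    ⨅-lower    : {I : Set s} (x : I → Carrier) → ∀ i → ⨅ x ⊑ x i
    ⨅-greatest : {I : Set s} (x : I → Carrier) → ∀ l → (∀ i → l ⊑ x i) → l ⊑ ⨅ x

record Negotiation r : Set (suc r) where
  field
    #procs #nodes : ℕ

  Proc : Set
  Proc = Fin #procs

  Node : Set
  Node = Fin #nodes

  field
    dom          : Node → Subset #procs
    dom-nonempty : ∀ n → Nonempty (dom n)
    R            : Set r
    out          : Node → Pred R r
    δ            : ∀ n a → .(out n a) → ∀ p → .(p ∈ dom n) → Subset #nodes
    δ-dom        : ∀ n a .(a∈ : out n a) p (p∈ : p ∈ dom n) →
                   ∀ {n′} → n′ ∈ δ n a a∈ p p∈ → p ∈ dom n′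
    n-init n-fin : Node
    dom-init     : dom n-init ≡ ⊤
    dom-fin      : dom n-fin ≡ ⊤
    out-nonempty : ∀ n → n ≢ n-fin → ∃[ a ] out n a

  -- The proof of allowedness is irrelevant, so a location is determined by
  -- its node and its outcome.
  record Location : Set r where
    eta-equality
    constructor loc
    field
      node     : Node
      outcome  : R
      .allowed : out node outcome

  open Location public

  domˡ : Location → Subset #procs
  domˡ ℓ = dom (node ℓ)

  δˡ : (ℓ : Location) (p : Proc) → .(p ∈ domˡ ℓ) → Subset #nodes
  δˡ (loc n a a∈) p p∈ = δ n a a∈ p p∈

  Independent : Location → Location → Set
  Independent ℓ₁ ℓ₂ = Empty (domˡ ℓ₁ ∩ domˡ ℓ₂)

  Deterministic : Set r
  Deterministic = ∀ ℓ p (p∈ : p ∈ domˡ ℓ) →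
    (∃[ n ] δˡ ℓ p p∈ ≡ ⁅ n ⁆) ⊎ Empty (δˡ ℓ p p∈)

  Configuration : Set
  Configuration = Proc → Subset #nodes

  C-init C-fin : Configuration
  C-init _ = ⁅ n-init ⁆
  C-fin  _ = ⁅ n-fin ⁆

  Enabled : Configuration → Node → Set
  Enabled C n = ∀ {p} → p ∈ dom n → n ∈ C p

  -- Configurations are functions, so they are compared pointwise.
  record Step (C : Configuration) (ℓ : Location) (C′ : Configuration) : Set where
    field
      enabled : Enabled C (node ℓ)
      moved   : ∀ p (p∈ : p ∈ domˡ ℓ) → C′ p ≡ δˡ ℓ p p∈
      kept    : ∀ p → p ∉ domˡ ℓ → C′ p ≡ C p

  data Run : Configuration → List Location → Configuration → Set r where
    []  : ∀ {C C′} → C ≗ C′ → Run C [] C′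
    _∷_ : ∀ {C ℓ C′ w C″} → Step C ℓ C′ → Run C′ w C″ → Run C (ℓ ∷ w) C″

  Successful : Pred (List Location) r
  Successful w = Run C-init w C-fin

  -- A partial function on runs is a map into Maybe that is undefined outside
  -- the runs from C-init at whose end some node is enabled.
  record Scheduler : Set r where
    field
      choose : List Location → Maybe Node
      sound  : ∀ {w n} → choose w ≡ just n →
               ∃[ C ] Run C-init w C × Enabled C n
      total  : ∀ {w C} → Run C-init w C → (∃[ n ] Enabled C n) →
               ∃[ n ] choose w ≡ just n

  open Scheduler public

  -- No choice is imposed at the empty prefix: only n-init is enabled there.
  Compatible : Scheduler → Pred (List Location) r
  Compatible S w = ∀ u ℓ v → w ≡ u ++ ℓ ∷ v → u ≢ [] → choose S u ≡ just (node ℓ)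

record AnalysisFramework {r} (𝒩 : Negotiation r) c ℓ₁ ℓ₂ : Set (suc (r ⊔ c ⊔ ℓ₁ ⊔ ℓ₂)) where
  open Negotiation 𝒩

  field
    completeLattice : CompleteLattice c ℓ₁ ℓ₂ r

  open CompleteLattice completeLattice public

  field
    ⟦_⟧ˡ         : Location → Carrier → Carrier
    monotone     : ∀ ℓ → Monotonic₁ _⊑_ _⊑_ ⟦ ℓ ⟧ˡ
    distributive : ∀ ℓ {I : Set r} → I → (x : I → Carrier) →
                   ⟦ ℓ ⟧ˡ (⨆ x) ≈ ⨆ (λ i → ⟦ ℓ ⟧ˡ (x i))

  ⟦_⟧ : List Location → Carrier → Carrier
  ⟦ [] ⟧    d = d
  ⟦ ℓ ∷ w ⟧ d = ⟦ w ⟧ (⟦ ℓ ⟧ˡ d)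

  ⟦𝒩,_⟧ : Scheduler → Carrier → Carrier
  ⟦𝒩, S ⟧ d = ⨆ {I = Σ (List Location) λ w → Successful w × Compatible S w}
                (λ i → ⟦ proj₁ i ⟧ d)

  ⟦𝒩⟧-inf ⟦𝒩⟧-sup : Carrier → Carrier
  ⟦𝒩⟧-inf d = ⨅ {I = Scheduler} (λ S → ⟦𝒩, S ⟧ d)
  ⟦𝒩⟧-sup d = ⨆ {I = Scheduler} (λ S → ⟦𝒩, S ⟧ d)

  MazurkiewiczInvariant : Set (r ⊔ c ⊔ ℓ₁)
  MazurkiewiczInvariant = ∀ ℓ ℓ′ → Independent ℓ ℓ′ →
    ∀ d → ⟦ ℓ ⟧ˡ (⟦ ℓ′ ⟧ˡ d) ≈ ⟦ ℓ′ ⟧ˡ (⟦ ℓ ⟧ˡ d)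

{-# OPTIONS --safe #-}
module Submission where

open import Defs
open import Level using (Level)
open import Data.Empty using (⊥-elim)
open import Data.Fin.Properties using (_≟_)
open import Data.Fin.Subset using (_∈_; _∉_; _∩_; Empty)
open import Data.Fin.Subset.Properties using (_∈?_; ∈⊤; x∈⁅y⁆⇒x≡y; x∈p∩q⁺; x∈p∩q⁻)
open import Data.List using (List; []; _∷_; _++_; _∷ʳ_; length)
open import Data.List.Properties using (++-assoc; ++-identityʳ)
open import Data.List.Relation.Unary.All using (All; []; _∷_)
open import Data.Maybe using (just)
open import Data.Nat using (suc)
open import Data.Nat.Properties using (suc-injective)
open import Data.Product using (_×_; _,_; proj₁; proj₂; ∃-syntax)
open import Data.Sum using (_⊎_; inj₁; inj₂)
open import Relation.Binary.PropositionalEquality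
  using (_≡_; _≗_; refl; sym; trans; cong; subst)
open import Relation.Nullary using (yes; no)

-- Fix a successful run and replay it under a scheduler S.  When S picks an
-- enabled node n, every process of n waits at n only, so the first location of
-- the remaining run that touches dom n has node n and is independent of all
-- earlier ones: it can be moved to the front without changing the semantics.
-- Such a location exists, because otherwise n = n-fin, whose domain meets every
-- location.  Hence every successful run has the semantics of one compatible
-- with S, and the joins for all schedulers coincide.

module Replay {r} (𝒩 : Negotiation r) where
  open Negotiation 𝒩

  -- The form in which determinism is used: an invariant of every reachable configuration. A process
  -- may also wait nowhere, since `δ` may be empty.
  Functional : Configuration → Set
  Functional C = ∀ p {m n} → m ∈ C p → n ∈ C p → m ≡ n

  C-init-functional : Functional C-init
  C-init-functional _ m∈ n∈ =
    trans (x∈⁅y⁆⇒x≡y n-init m∈) (sym (x∈⁅y⁆⇒x≡y n-init n∈))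

  step-functional : Deterministic → ∀ {C ℓ C′} →
    Step C ℓ C′ → Functional C → Functional C′
  step-functional det {ℓ = ℓ} s fun p m∈ n∈ with p ∈? domˡ ℓ
  ... | no p∉ = fun p (subst (_ ∈_) (Step.kept s p p∉) m∈)
                      (subst (_ ∈_) (Step.kept s p p∉) n∈)
  ... | yes p∈ with subst (_ ∈_) (Step.moved s p p∈) m∈
                  | subst (_ ∈_) (Step.moved s p p∈) n∈ | det ℓ p p∈
  ...   | m∈δ | n∈δ | inj₁ (x , δ≡) =
    trans (x∈⁅y⁆⇒x≡y x (subst (_ ∈_) δ≡ m∈δ))
          (sym (x∈⁅y⁆⇒x≡y x (subst (_ ∈_) δ≡ n∈δ)))
  ...   | m∈δ | _   | inj₂ empty    = ⊥-elim (empty (_ , m∈δ))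

  disjoint-∉ : ∀ ℓ ℓ′ {p} → Independent ℓ ℓ′ → p ∈ domˡ ℓ → p ∉ domˡ ℓ′
  disjoint-∉ _ _ ind p∈ p∈′ = ind (_ , x∈p∩q⁺ (p∈ , p∈′))

  step-unique : ∀ {C D ℓ C′ D′} → C ≗ D → Step C ℓ C′ → Step D ℓ D′ → C′ ≗ D′
  step-unique {ℓ = ℓ} C≗D s t p with p ∈? domˡ ℓ
  ... | yes p∈ = trans (Step.moved s p p∈) (sym (Step.moved t p p∈))
  ... | no p∉  =
    trans (Step.kept s p p∉) (trans (C≗D p) (sym (Step.kept t p p∉)))

  run-unique : ∀ {C D w C′ D′} → C ≗ D → Run C w C′ → Run D w D′ → C′ ≗ D′
  run-unique C≗D ([] C≗C′) ([] D≗D′) p =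
    trans (sym (C≗C′ p)) (trans (C≗D p) (D≗D′ p))
  run-unique C≗D (s ∷ ρ) (t ∷ σ) = run-unique (step-unique C≗D s t) ρ σ

  step-resp-≗ : ∀ {C D ℓ C′} → C ≗ D → Step D ℓ C′ → Step C ℓ C′
  step-resp-≗ C≗D s = record
    { enabled = λ {p} p∈ → subst (_ ∈_) (sym (C≗D p)) (Step.enabled s p∈)
    ; moved   = Step.moved s
    ; kept    = λ p p∉ → trans (Step.kept s p p∉) (sym (C≗D p))
    }

  run-∷ʳ : ∀ {C w C′ ℓ C″} → Run C w C′ → Step C′ ℓ C″ → Run C (w ∷ʳ ℓ) C″
  run-∷ʳ ([] C≗C′) t = step-resp-≗ C≗C′ t ∷ [] (λ _ → refl)
  run-∷ʳ (s ∷ ρ)   t = s ∷ run-∷ʳ ρ t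

  step-swap : ∀ {C ℓ C′ ℓ′ C″} → Independent ℓ ℓ′ → Step C ℓ C′ → Step C′ ℓ′ C″ →
    ∃[ E ] Step C ℓ′ E × Step E ℓ C″
  step-swap {C} {ℓ} {C′} {ℓ′} {C″} ind s t = E , first , second
    where
    -- Only `ℓ′` has acted in `E`. Its processes are untouched by `ℓ`, so they already have their
    -- values in `C″`.
    E : Configuration
    E p with p ∈? domˡ ℓ′
    ... | yes _ = C″ p
    ... | no _  = C p

    E-inside : ∀ p → p ∈ domˡ ℓ′ → E p ≡ C″ p
    E-inside p p∈ with p ∈? domˡ ℓ′
    ... | yes _ = refl
    ... | no p∉ = ⊥-elim (p∉ p∈)

    E-outside : ∀ p → p ∉ domˡ ℓ′ → E p ≡ C p
    E-outside p p∉ with p ∈? domˡ ℓ′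
    ... | yes p∈ = ⊥-elim (p∉ p∈)
    ... | no _   = refl

    first : Step C ℓ′ E
    first = record
      { enabled = λ {p} p∈ →
          subst (_ ∈_) (Step.kept s p (λ p∈ℓ → disjoint-∉ ℓ ℓ′ ind p∈ℓ p∈))
                (Step.enabled t p∈)
      ; moved   = λ p p∈ → trans (E-inside p p∈) (Step.moved t p p∈)
      ; kept    = E-outside
      }

    kept″ : ∀ p → p ∉ domˡ ℓ → C″ p ≡ E p
    kept″ p p∉ with p ∈? domˡ ℓ′
    ... | yes _  = refl
    ... | no p∉′ = trans (Step.kept t p p∉′) (Step.kept s p p∉)

    second : Step E ℓ C″
    second = record
      { enabled = λ {p} p∈ →
          subst (_ ∈_) (sym (E-outside p (disjoint-∉ ℓ ℓ′ ind p∈))) (Step.enabled s p∈)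
      ; moved   = λ p p∈ →
          trans (Step.kept t p (disjoint-∉ ℓ ℓ′ ind p∈)) (Step.moved s p p∈)
      ; kept    = kept″
      }

  -- The fragment of Mazurkiewicz trace equivalence that the replay needs: `w` is equivalent to
  -- `ℓ ∷ v` by moving one occurrence of `ℓ` to the front.
  data Extraction (ℓ : Location) : List Location → List Location → Set r where
    here  : ∀ {w} → Extraction ℓ (ℓ ∷ w) w
    there : ∀ {m w v} → Independent m ℓ → Extraction ℓ w v →
            Extraction ℓ (m ∷ w) (m ∷ v)

  extraction-length : ∀ {ℓ w v} → Extraction ℓ w v → length w ≡ suc (length v)
  extraction-length here        = refl
  extraction-length (there _ x) = cong suc (extraction-length x)

  run-extraction : ∀ {C D ℓ w v} → Extraction ℓ w v → Run C w D → Run C (ℓ ∷ v) D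
  run-extraction here          ρ       = ρ
  run-extraction (there ind x) (s ∷ ρ) with run-extraction x ρ
  ... | t ∷ σ with step-swap ind s t
  ...   | _ , t′ , s′ = t′ ∷ (s′ ∷ σ)

  AvoidsNode : Node → Location → Set
  AvoidsNode n ℓ = Empty (domˡ ℓ ∩ dom n)

  -- Until a location with node `n` occurs, none touches `dom n`: a shared process would wait at two
  -- nodes. So `n` stays enabled in the meantime.
  extract : Deterministic → ∀ {C D w n} → Functional C → Enabled C n → Run C w D →
    (All (AvoidsNode n) w × Enabled D n) ⊎
    (∃[ ℓ ] ∃[ v ] node ℓ ≡ n × Extraction ℓ w v)
  extract det fun en ([] C≗D) =
    inj₁ ([] , λ {p} p∈ → subst (_ ∈_) (C≗D p) (en p∈))
  extract det {n = n} fun en (_∷_ {ℓ = m} {C′ = C′} s ρ) with node m ≟ n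
  ... | yes m≡n = inj₂ (m , _ , m≡n , here)
  ... | no m≢n  = delay (extract det (step-functional det s fun) enabled′ ρ)
    where
    avoids : AvoidsNode n m
    avoids (p , p∈) with x∈p∩q⁻ (domˡ m) (dom n) p∈
    ... | p∈m , p∈n = m≢n (fun p (Step.enabled s p∈m) (en p∈n))

    enabled′ : Enabled C′ n
    enabled′ {p} p∈ = subst (n ∈_)
      (sym (Step.kept s p λ p∈m → avoids (p , x∈p∩q⁺ (p∈m , p∈)))) (en p∈)

    delay : ∀ {D w} →
      (All (AvoidsNode n) w × Enabled D n) ⊎
      (∃[ ℓ ] ∃[ v ] node ℓ ≡ n × Extraction ℓ w v) →
      (All (AvoidsNode n) (m ∷ w) × Enabled D n) ⊎
      (∃[ ℓ ] ∃[ v ] node ℓ ≡ n × Extraction ℓ (m ∷ w) v)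
    delay (inj₁ (all , en-D))         = inj₁ (avoids ∷ all , λ {p} → en-D {p})
    -- With `n` unified with `node ℓ`, `avoids` is literally a proof of `Independent m ℓ`.
    delay (inj₂ (ℓ , _ , refl , x))   = inj₂ (ℓ , _ , refl , there avoids x)

  extract-successful : Deterministic → ∀ {C m w n} →
    Functional C → Enabled C n → Run C (m ∷ w) C-fin →
    ∃[ ℓ ] ∃[ v ] node ℓ ≡ n × Extraction ℓ (m ∷ w) v
  extract-successful det {m = m} {n = n} fun en ρ with extract det fun en ρ
  ... | inj₂ found = found
  ... | inj₁ (avoids ∷ _ , en-fin)
    -- A process of `n` waits only at `n-fin` in `C-fin`, so `n` is `n-fin`; its domain is all of
    -- `Proc` and cannot be avoided by `m`.
    with x∈⁅y⁆⇒x≡y n-fin (en-fin (proj₂ (dom-nonempty n)))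
  ...   | refl with dom-nonempty (node m)
  ...     | p , p∈ = ⊥-elim (avoids (p , x∈p∩q⁺ (p∈ , subst (p ∈_) (sym dom-fin) ∈⊤)))

  -- `sound` yields some configuration reached by `u`; a word leads to only one, so it agrees with
  -- `C`.
  choose-enabled : ∀ S {u C n} → Run C-init u C → choose S u ≡ just n → Enabled C n
  choose-enabled S {n = n} ρ eq {p} p∈ with sound S eq
  ... | _ , σ , en = subst (n ∈_) (run-unique (λ _ → refl) σ ρ p) (en p∈)

  -- Compatibility by induction, with `u` the prefix already executed. It is stricter than
  -- `Compatible`: the choice at the empty prefix is constrained as well.
  data Follows (S : Scheduler) (u : List Location) : List Location → Set r where
    []  : Follows S u []
    _∷_ : ∀ {ℓ w} → choose S u ≡ just (node ℓ) → Follows S (u ∷ʳ ℓ) w →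
          Follows S u (ℓ ∷ w)

  follows-choose : ∀ {S u} v {ℓ w} → Follows S u (v ++ ℓ ∷ w) →
    choose S (u ++ v) ≡ just (node ℓ)
  follows-choose {S} {u} []      (eq ∷ _) = trans (cong (choose S) (++-identityʳ u)) eq
  follows-choose {S} {u} (m ∷ v) (_ ∷ f)  =
    trans (cong (choose S) (sym (++-assoc u (m ∷ []) v))) (follows-choose v f)

  follows⇒compatible : ∀ {S w} → Follows S [] w → Compatible S w
  follows⇒compatible f u _ _ refl _ = follows-choose u f

module Invariance {r c ℓ₁ ℓ₂} (𝒩 : Negotiation r) (𝒜 : AnalysisFramework 𝒩 c ℓ₁ ℓ₂)
  (det : Negotiation.Deterministic 𝒩)
  (inv : AnalysisFramework.MazurkiewiczInvariant 𝒜) where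
  open Negotiation 𝒩
  open AnalysisFramework 𝒜 renaming (trans to ⊑-trans; refl to ⊑-refl)
  open Replay 𝒩

  -- Monotonicity in both directions gives congruence for `≈`.
  ⟦⟧ˡ-cong : ∀ ℓ {d e} → d ≈ e → ⟦ ℓ ⟧ˡ d ≈ ⟦ ℓ ⟧ˡ e
  ⟦⟧ˡ-cong ℓ d≈e = antisym (monotone ℓ (reflexive d≈e))
                           (monotone ℓ (reflexive (Eq.sym d≈e)))

  ⟦⟧-cong : ∀ w {d e} → d ≈ e → ⟦ w ⟧ d ≈ ⟦ w ⟧ e
  ⟦⟧-cong []      d≈e = d≈e
  ⟦⟧-cong (ℓ ∷ w) d≈e = ⟦⟧-cong w (⟦⟧ˡ-cong ℓ d≈e)

  ⟦⟧-extraction : ∀ {ℓ w v} → Extraction ℓ w v → ∀ d → ⟦ w ⟧ d ≈ ⟦ ℓ ∷ v ⟧ d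
  ⟦⟧-extraction here d = Eq.refl
  ⟦⟧-extraction {ℓ} (there {m} {v = v} ind x) d =
    Eq.trans (⟦⟧-extraction x (⟦ m ⟧ˡ d))
             (⟦⟧-cong v (Eq.sym (inv m ℓ ind d)))

  -- The induction is on the length `k`, because the remainder `v` left by an extraction is not a
  -- subterm of `w`.
  replay : ∀ S k {u C w} → length w ≡ k → Functional C →
    Run C-init u C → Run C w C-fin →
    ∃[ w′ ] Run C w′ C-fin × Follows S u w′ × (∀ d → ⟦ w ⟧ d ≈ ⟦ w′ ⟧ d)
  replay S _ {w = []} _ fun ρ σ = [] , σ , [] , λ _ → Eq.refl
  replay S (suc k) {w = m ∷ w} len fun ρ (s ∷ σ)
    -- The next location of the given run shows that some node is enabled, so `S` must make a choice
    -- after `u`.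
    with total S ρ (node m , Step.enabled s)
  ... | n , eq with extract-successful det fun (choose-enabled S ρ eq) (s ∷ σ)
  ...   | ℓ , v , refl , x with run-extraction x (s ∷ σ)
  ...     | t ∷ τ
    with replay S k (suc-injective (trans (sym (extraction-length x)) len))
                (step-functional det t fun) (run-∷ʳ ρ t) τ
  ...       | w′ , τ′ , f , w≈ =
    ℓ ∷ w′ , t ∷ τ′ , eq ∷ f ,
    λ d → Eq.trans (⟦⟧-extraction x d) (w≈ (⟦ ℓ ⟧ˡ d))

  ⟦𝒩,⟧-⊑ : ∀ S S′ d → ⟦𝒩, S ⟧ d ⊑ ⟦𝒩, S′ ⟧ d
  ⟦𝒩,⟧-⊑ S S′ d = ⨆-least _ _ bound
    where
    bound : ∀ i → ⟦ proj₁ i ⟧ d ⊑ ⟦𝒩, S′ ⟧ d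
    bound (w , ρ , _) with replay S′ (length w) refl C-init-functional ([] λ _ → refl) ρ
    ... | w′ , ρ′ , f , w≈ =
      ⊑-trans (reflexive (w≈ d)) (⨆-upper _ (w′ , ρ′ , follows⇒compatible f))

  ⟦𝒩,⟧-≈ : ∀ S S′ d → ⟦𝒩, S ⟧ d ≈ ⟦𝒩, S′ ⟧ d
  ⟦𝒩,⟧-≈ S S′ d = antisym (⟦𝒩,⟧-⊑ S S′ d) (⟦𝒩,⟧-⊑ S′ S d)

theorem1 : ∀ {r c ℓ₁ ℓ₂ : Level} (𝒩 : Negotiation r) (𝒜 : AnalysisFramework 𝒩 c ℓ₁ ℓ₂) →
    let open Negotiation 𝒩
        open AnalysisFramework 𝒜
    in Deterministic → MazurkiewiczInvariant →
       (∀ (S S′ : Scheduler) → ∀ d → ⟦𝒩, S ⟧ d ≈ ⟦𝒩, S′ ⟧ d) ×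
       (∀ (S : Scheduler) → ∀ d → ⟦𝒩⟧-inf d ≈ ⟦𝒩, S ⟧ d) ×
       (∀ (S : Scheduler) → ∀ d → ⟦𝒩⟧-sup d ≈ ⟦𝒩, S ⟧ d)
theorem1 𝒩 𝒜 det inv =
  ⟦𝒩,⟧-≈ ,
  -- All members of the family agree and `S` is one of them, so meet and join both equal its value.
  (λ S d → antisym (⨅-lower _ S) (⨅-greatest _ _ λ S′ → ⟦𝒩,⟧-⊑ S S′ d)) ,
  (λ S d → antisym (⨆-least _ _ λ S′ → ⟦𝒩,⟧-⊑ S′ S d) (⨆-upper _ S))
  where
  open AnalysisFramework 𝒜
  open Invariance 𝒩 𝒜 det inv
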